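{- Let $p$ be a prime with $p>48$, let $N$ be a multiple of $p^2$, and let $F:\mathbb{B}\to(\mathbb{Z}/p\mathbb{Z})^\times$ be an $\mathcal{S}_{p,N}$-Sudoku solution. Then there exist integers $A,B,C$, not all divisible by $p$, such that $F(n,m)=\pi_p(An+Bm+C)$ whenever $(n,m)\in\mathbb{B}$ satisfies $\nu_p(An+Bm+C)=0$. Furthermore, the coefficients $A,B,C$ are uniquely determined modulo $p$ (any two such triples, each not all divisible by $p$, agree modulo $p$), and $F$ has non-constant columns if and only if $p\nmid B$.
   Context: $\pi_p:\mathbb{Z}\to\mathbb{Z}/p\mathbb{Z}$ is reduction mod $p$, $(\mathbb{Z}/p\mathbb{Z})^\times=(\mathbb{Z}/p\mathbb{Z})\setminus\{0\}$, $\nu_p$ is the $p$-adic valuation with $\nu_p(0)=+\infty$. Define $f_p(n)=\pi_p(n/p^{\nu_p(n)})$ for $n\ne0$ and $f_p(0)=1\bmod p$. The Sudoku board is $\mathbb{B}=\{0,\dots,N-1\}\times\mathbb{Z}$. The Sudoku rule $\mathcal{S}_{p,N}$ is the set of functions $g:\{0,\dots,N-1\}\to(\mathbb{Z}/p\mathbb{Z})^\times$ for which there exist integers $a,b$, not both divisible by $p$, such that $g(n)=f_p(an+b)$ for all $n\in\{0,\dots,N-1\}$ with $\nu_p(an+b)\le1$. An $\mathcal{S}_{p,N}$-Sudoku solution is $F:\mathbb{B}\to(\mathbb{Z}/p\mathbb{Z})^\times$ such that for all $j,i\in\mathbb{Z}$ the function $n\mapsto F(n,jn+i)$ lies in $\mathcal{S}_{p,N}$.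 $F$ has non-constant columns if for every $n\in\{0,\dots,N-1\}$, $m\mapsto F(n,m)$ is non-constant. -}

module Defs where

open import Data.Nat as ℕ using (ℕ; zero; suc; NonZero)
open import Data.Nat.Divisibility as ℕD using (_∣?_)
open import Data.Integer as ℤ using (ℤ; +_; _+_; _*_; ∣_∣; _%ℕ_; _/ℕ_)
open import Data.Integer.DivMod using (n%ℕd<d)
open import Data.Integer.Divisibility as ℤD using ()
open import Data.Fin using (Fin; fromℕ<; toℕ)
open import Data.Product using (Σ; ∃; ∃-syntax; _×_; _,_)
open import Relation.Nullary using (¬_; yes; no)
open import Relation.Binary.PropositionalEquality using (_≡_; _≢_)

_∣ℤ_ : ℤ → ℤ → Set
_∣ℤ_ = ℤD._∣_

π : (p : ℕ) .{{_ : NonZero p}} → ℤ → Fin p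
π p z = fromℕ< (n%ℕd<d z p)

ν≡0 : ℕ → ℤ → Set
ν≡0 p x = ¬ ((+ p) ∣ℤ x)

-- ν_p(x) ≤ 1, i.e. p² ∤ x  (note ν_p(0) = +∞, and p² ∣ 0)
ν≤1 : ℕ → ℤ → Set
ν≤1 p x = ¬ ((+ (p ℕ.* p)) ∣ℤ x)

-- repeatedly divide out p (fuel bounds the number of divisions;
-- ∣x∣ fuel suffices since ν_p(x) ≤ ∣x∣ for x ≠ 0)
strip : (p : ℕ) .{{_ : NonZero p}} → ℕ → ℤ → ℤ
strip p zero    x = x
strip p (suc k) x with p ∣? ∣ x ∣
... | yes _ = strip p k (x /ℕ p)
... | no  _ = x

f : (p : ℕ) .{{_ : NonZero p}} → ℤ → Fin p
f p (+ zero) = π p (+ 1)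
f p x        = π p (strip p ∣ x ∣ x)

NotBoth : ℕ → ℤ → ℤ → Set
NotBoth p a b = ¬ (((+ p) ∣ℤ a) × ((+ p) ∣ℤ b))

NotAll : ℕ → ℤ → ℤ → ℤ → Set
NotAll p a b c = ¬ (((+ p) ∣ℤ a) × ((+ p) ∣ℤ b) × ((+ p) ∣ℤ c))

ι : {N : ℕ} → Fin N → ℤ
ι n = + (toℕ n)

-- The Sudoku rule S_{p,N}: g ∈ S_{p,N}
-- (g takes values in (ℤ/pℤ)^× ; membership of values in the units is
-- imposed on the Sudoku solution F below)
InRule : (p N : ℕ) .{{_ : NonZero p}} → (Fin N → Fin p) → Set
InRule p N g = ∃[ a ] ∃[ b ] NotBoth p a b ×
  ((n : Fin N) → ν≤1 p (a * ι n + b) → g n ≡ f p (a * ι n + b))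

IsUnit : {p : ℕ} → Fin p → Set
IsUnit x = toℕ x ≢ 0

IsSudokuSolution : (p N : ℕ) .{{_ : NonZero p}} → (Fin N → ℤ → Fin p) → Set
IsSudokuSolution p N F =
  ((n : Fin N) (m : ℤ) → IsUnit (F n m)) ×
  ((j i : ℤ) → InRule p N (λ n → F n (j * ι n + i)))

NonConstantColumns : {p N : ℕ} → (Fin N → ℤ → Fin p) → Set
NonConstantColumns F = ∀ n → ¬ (∀ m m′ → F n m ≡ F n m′)

Represents : (p N : ℕ) .{{_ : NonZero p}} → (Fin N → ℤ → Fin p) → ℤ → ℤ → ℤ → Set
Represents p N F A B C =
  (n : Fin N) (m : ℤ) → ν≡0 p (A * ι n + B * m + C) → F n m ≡ π p (A * ι n + B * m + C)

{-# OPTIONS --safe #-}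
module Submission where

-- Modulo p, F agrees on every line with a non-zero affine function of n off the zeros of that function.
-- Take the rows 0, ..., 15 and three lines, of slopes 1, 1 and -1, placed by a common horizontal shift t.
-- Since 16 * 3 = 48 < p, some t puts all 48 crossings off the zeros of the row functions. Each of the three
-- lines has its zero on at most one row, so one of the four blocks of four consecutive rows is free of zeros;
-- there rows and lines agree at all crossings, which forces the four row functions to be the restrictions
-- of a single affine form A n + B m + C. Lines of slope 1 and -1 then carry this form from four consecutive
-- rows to the next row above or below.

open import Defs
open import Data.Nat as ℕ using (ℕ; suc; NonZero; s≤s; z≤n)
import Data.Nat.Properties as ℕP
import Data.Nat.Divisibility as ℕD
open import Data.Nat.Divisibility using (_∣_)
open import Data.Nat.Primality using (Prime; euclidsLemma)
open import Data.Integer as ℤ using (ℤ; +_; 0ℤ; 1ℤ; -1ℤ; ∣_∣; _%ℕ_; _/ℕ_)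
import Data.Integer.Properties as ℤP
import Data.Integer.DivMod as ℤDM
import Data.Integer.Divisibility.Signed as ℤS
open import Data.Integer.Tactic.RingSolver using (solve-∀)
open import Data.Fin using (Fin; toℕ; fromℕ<; combine; remQuot; opposite; inject≤)
open import Data.Fin.Patterns using (0F; 1F; 2F; 3F)
import Data.Fin.Properties as FinP
open import Data.Product using (∃; ∃-syntax; _×_; _,_; proj₁; proj₂)
open import Data.Sum using (_⊎_; inj₁; inj₂; [_,_]′)
open import Relation.Nullary using (¬_; Dec; yes; no; contradiction; ¬?)
open import Relation.Nullary.Decidable using (decidable-stable; _×-dec_)
open import Relation.Binary.PropositionalEquality using (_≡_; refl; sym; trans; cong; cong₂; subst; module ≡-Reasoning)
open import Function using (_∘_)
open import Function.Bundles using (_⇔_; mk⇔)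

-- A pigeonhole principle for avoiding exceptional points.

-- If every `x` met some `Z i`, choosing such an `i` would send two points to the same index,
-- against `unique`.
avoid : ∀ {k M} → k ℕ.< M → (Z : Fin k → Fin M → Set) → (∀ i x → Dec (Z i x)) →
  (∀ i {x y} → Z i x → Z i y → x ≡ y) → ∃ λ x → ∀ i → ¬ Z i x
avoid {k} {M} k<M Z Z? unique with FinP.any? (λ x → FinP.all? (λ i → ¬? (Z? i x)))
... | yes found = found
... | no none = contradiction (unique (hit y) Zx (proj₂ (hits y))) (FinP.<⇒≢ x<y)
  where
  hits : ∀ x → ∃ λ i → Z i x
  hits x with i , ¬¬Z ← FinP.¬∀⟶∃¬ k _ (λ i → ¬? (Z? i x)) (none ∘ (x ,_)) =
    i , decidable-stable (Z? i x) ¬¬Z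
  hit : Fin M → Fin k
  hit = proj₁ ∘ hits
  collision = FinP.pigeonhole k<M hit
  x y : Fin M
  x = proj₁ collision
  y = proj₁ (proj₂ collision)
  x<y = proj₁ (proj₂ (proj₂ collision))
  Zx : Z (hit y) x
  Zx = subst (λ i → Z i x) (proj₂ (proj₂ (proj₂ collision))) (proj₂ (hits x))

-- Congruences modulo `p`.

module ModPrime (p : ℕ) .{{_ : NonZero p}} (p-prime : Prime p) where

  open import Data.Integer using (_+_; _*_; _-_; -_; +[1+_]; -[1+_])

  infix 4 p∣_
  p∣_ : ℤ → Set
  p∣ z = + p ℤS.∣ z

  p∣?_ : ∀ z → Dec (p∣ z)
  p∣? z = + p ℤS.∣? z

  -- With explicit coefficients, a congruence comes down to one polynomial identity for the ring
  -- solver.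
  ∣-lin₁ : ∀ c {e z} → p∣ e → z ≡ c * e → p∣ z
  ∣-lin₁ c p∣e refl = ℤS.∣n⇒∣m*n c p∣e

  ∣-lin₂ : ∀ c₁ c₂ {e₁ e₂ z} → p∣ e₁ → p∣ e₂ → z ≡ c₁ * e₁ + c₂ * e₂ → p∣ z
  ∣-lin₂ c₁ c₂ p∣e₁ p∣e₂ refl = ℤS.∣m∣n⇒∣m+n (ℤS.∣n⇒∣m*n c₁ p∣e₁) (ℤS.∣n⇒∣m*n c₂ p∣e₂)

  ∣-lin₃ : ∀ c₁ c₂ c₃ {e₁ e₂ e₃ z} → p∣ e₁ → p∣ e₂ → p∣ e₃ → z ≡ c₁ * e₁ + c₂ * e₂ + c₃ * e₃ → p∣ z
  ∣-lin₃ c₁ c₂ c₃ p∣e₁ p∣e₂ p∣e₃ refl = ℤS.∣m∣n⇒∣m+n (∣-lin₂ c₁ c₂ p∣e₁ p∣e₂ refl) (ℤS.∣n⇒∣m*n c₃ p∣e₃)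

  ∣-cong : ∀ {x y} → p∣ (x - y) → p∣ x → p∣ y
  ∣-cong {x} {y} d e = ∣-lin₂ -1ℤ 1ℤ d e (eq x y)
    where
    eq : ∀ x y → y ≡ -1ℤ * (x - y) + 1ℤ * x
    eq = solve-∀

  ≈-sym : ∀ x y → p∣ (x - y) → p∣ (y - x)
  ≈-sym x y d = ∣-lin₁ -1ℤ d (eq x y)
    where
    eq : ∀ x y → y - x ≡ -1ℤ * (x - y)
    eq = solve-∀

  ≈-trans : ∀ x y z → p∣ (x - y) → p∣ (y - z) → p∣ (x - z)
  ≈-trans x y z d e = ∣-lin₂ 1ℤ 1ℤ d e (eq x y z)
    where
    eq : ∀ x y z → x - z ≡ 1ℤ * (x - y) + 1ℤ * (y - z)
    eq = solve-∀

  euclid : ∀ x y → p∣ (x * y) → p∣ x ⊎ p∣ y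
  euclid x y d with euclidsLemma ∣ x ∣ ∣ y ∣ p-prime (subst (p ∣_) (ℤP.abs-* x y) (ℤS.∣⇒∣ᵤ d))
  ... | inj₁ e = inj₁ (ℤS.∣ᵤ⇒∣ e)
  ... | inj₂ e = inj₂ (ℤS.∣ᵤ⇒∣ e)

  ∤-small : ∀ {k} .{{_ : NonZero k}} → k ℕ.< p → ¬ p∣ (+ k)
  ∤-small k<p d = ℕD.>⇒∤ k<p (ℤS.∣⇒∣ᵤ d)

  residue-unique-≤ : ∀ {a b} → a ℕ.≤ b → b ℕ.< p → p∣ (+ b - + a) → a ≡ b
  residue-unique-≤ {a} {b} a≤b b<p d with b ℕ.∸ a in eq
  ... | ℕ.zero = ℕP.≤-antisym a≤b (ℕP.m∸n≡0⇒m≤n eq)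
  ... | suc k = contradiction (subst p∣_ b-a≡k d)
                  (∤-small (ℕP.≤-<-trans (ℕP.≤-trans (ℕP.≤-reflexive (sym eq)) (ℕP.m∸n≤m b a)) b<p))
    where
    b-a≡k : + b - + a ≡ + suc k
    b-a≡k = trans (ℤP.m-n≡m⊖n b a) (trans (ℤP.⊖-≥ a≤b) (cong +_ eq))

  residue-unique : ∀ {a b} → a ℕ.< p → b ℕ.< p → p∣ (+ a - + b) → a ≡ b
  residue-unique {a} {b} a<p b<p d with ℕP.≤-total a b
  ... | inj₁ a≤b = residue-unique-≤ a≤b b<p (≈-sym (+ a) (+ b) d)
  ... | inj₂ b≤a = sym (residue-unique-≤ b≤a a<p d)

  toℕ-π : ∀ z → p∣ (+ toℕ (π p z) - z)
  toℕ-π z = ∣-lin₁ (- (z /ℕ p)) ℤS.∣-refl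
    (trans (cong (λ r → + r - z) (FinP.toℕ-fromℕ< (ℤDM.n%ℕd<d z p)))
      (trans (cong (λ w → + (z %ℕ p) - w) (ℤDM.a≡a%ℕn+[a/ℕn]*n z p)) (eq (+ (z %ℕ p)) (z /ℕ p) (+ p))))
    where
    eq : ∀ r q p → r - (r + q * p) ≡ (- q) * p
    eq = solve-∀

  toℕ≈⇒≡π : ∀ {x : Fin p} z → p∣ (+ toℕ x - z) → x ≡ π p z
  toℕ≈⇒≡π {x} z d = FinP.toℕ-injective (residue-unique (FinP.toℕ<n x) (FinP.toℕ<n (π p z))
    (≈-trans (+ toℕ x) z _ d (≈-sym (+ toℕ (π p z)) z (toℕ-π z))))

  ≡π⇒toℕ≈ : ∀ {x : Fin p} z → x ≡ π p z → p∣ (+ toℕ x - z)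
  ≡π⇒toℕ≈ z refl = toℕ-π z

  ≈⇒π≡π : ∀ x y → p∣ (x - y) → π p x ≡ π p y
  ≈⇒π≡π x y d = toℕ≈⇒≡π y (≈-trans (+ toℕ (π p x)) x y (toℕ-π x) d)

  -- `strip` stops at its first test when `p` does not divide `z`.
  f≡π : ∀ z → ¬ p∣ z → f p z ≡ π p z
  f≡π z p∤z with z
  ... | + 0 = contradiction (ℤS.divides 0ℤ refl) p∤z
  ... | +[1+ n ] with p ℕD.∣? suc n
  ...   | yes d = contradiction (ℤS.∣ᵤ⇒∣ d) p∤z
  ...   | no _ = refl
  f≡π z p∤z | -[1+ n ] with p ℕD.∣? suc n
  ...   | yes d = contradiction (ℤS.∣ᵤ⇒∣ d) p∤z
  ...   | no _ = refl

  -- Affine functions over the field with `p` elements.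

  NonVanishing : ℤ → ℤ → Set
  NonVanishing a b = ¬ (p∣ a × p∣ b)

  -- Subtraction leaves `a * (x - y)`; if `p` divided `a`, a root would force it to divide `b` too.
  root-unique : ∀ a b x y → NonVanishing a b → p∣ (a * x + b) → p∣ (a * y + b) → p∣ (x - y)
  root-unique a b x y nv dx dy =
    [ (λ p∣a → contradiction (p∣a , ∣-lin₂ 1ℤ (- x) dx p∣a (eq₂ a b x)) nv) , (λ d → d) ]′
    (euclid a (x - y) (∣-lin₂ 1ℤ -1ℤ dx dy (eq₁ a b x y)))
    where
    eq₁ : ∀ a b x y → a * (x - y) ≡ 1ℤ * (a * x + b) + -1ℤ * (a * y + b)
    eq₁ = solve-∀
    eq₂ : ∀ a b x → b ≡ 1ℤ * (a * x + b) + (- x) * a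
    eq₂ = solve-∀

  -- The difference of the two functions is affine with two distinct roots.
  agree-twice : ∀ a b c d x y → ¬ p∣ (x - y) →
    p∣ (a * x + b - (c * x + d)) → p∣ (a * y + b - (c * y + d)) → p∣ (a - c) × p∣ (b - d)
  agree-twice a b c d x y x≉y dx dy with (p∣? (a - c)) ×-dec (p∣? (b - d))
  ... | yes both = both
  ... | no nv = contradiction (root-unique (a - c) (b - d) x y nv (diff x dx) (diff y dy)) x≉y
    where
    eq : ∀ a b c d x → (a - c) * x + (b - d) ≡ 1ℤ * (a * x + b - (c * x + d))
    eq = solve-∀
    diff : ∀ x → p∣ (a * x + b - (c * x + d)) → p∣ ((a - c) * x + (b - d))
    diff x e = ∣-lin₁ 1ℤ e (eq a b c d x)

  Distinct : ∀ {M} → (Fin M → ℤ) → Set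
  Distinct x = ∀ {s s′} → p∣ (x s - x s′) → s ≡ s′

  ι-distinct : ∀ {M} → M ℕ.≤ p → Distinct (ι {M})
  ι-distinct M≤p {s} {s′} d = FinP.toℕ-injective
    (residue-unique (ℕP.<-≤-trans (FinP.toℕ<n s) M≤p) (ℕP.<-≤-trans (FinP.toℕ<n s′) M≤p) d)

  avoid-roots : ∀ {k M} → k ℕ.< M → (a b : Fin k → ℤ) → (∀ i → NonVanishing (a i) (b i)) →
    (x : Fin M → ℤ) → Distinct x → ∃ λ s → ∀ i → ¬ p∣ (a i * x s + b i)
  avoid-roots k<M a b nv x distinct = avoid k<M (λ i s → p∣ (a i * x s + b i)) (λ i s → p∣? _)
    (λ i {s} {s′} ds ds′ → distinct (root-unique (a i) (b i) (x s) (x s′) (nv i) ds ds′))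

  -- Each of the two affine functions vanishes at one sample at most, so both match g at two samples.
  descriptions-agree : ∀ a b c d (x g : Fin 4 → ℤ) → 1 ℕ.< p → Distinct x → NonVanishing a b → NonVanishing c d →
    (∀ s → ¬ p∣ (a * x s + b) → p∣ (g s - (a * x s + b))) →
    (∀ s → ¬ p∣ (c * x s + d) → p∣ (g s - (c * x s + d))) →
    p∣ (a - c) × p∣ (b - d)
  descriptions-agree a b c d x g 1<p distinct nv-ab nv-cd ab cd =
    agree-twice a b c d (x s) (x s′) s≉s′
      (match s (clean₁ 1F) (clean₁ 2F)) (match s′ (clean₂ 1F) (clean₂ 2F))
    where
    slopes : Fin 3 → ℤ
    -- Entry `0F` is the function `x - u`: avoiding its root keeps the second sample away from the
    -- first.
    slopes 0F = 1ℤ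
    slopes 1F = a
    slopes 2F = c
    consts : ℤ → Fin 3 → ℤ
    consts u 0F = - u
    consts u 1F = b
    consts u 2F = d
    nv : ∀ u i → NonVanishing (slopes i) (consts u i)
    nv u 0F (p∣1 , _) = ∤-small 1<p p∣1
    nv u 1F = nv-ab
    nv u 2F = nv-cd
    first : ∃ λ s → ∀ i → ¬ p∣ (slopes i * x s + consts (x 0F) i)
    -- `x 0F` is a default here; four samples still exceed three roots.
    first = avoid-roots ℕP.≤-refl slopes (consts (x 0F)) (nv (x 0F)) x distinct
    s : Fin 4
    s = proj₁ first
    clean₁ = proj₂ first
    second : ∃ λ s′ → ∀ i → ¬ p∣ (slopes i * x s′ + consts (x s) i)
    second = avoid-roots ℕP.≤-refl slopes (consts (x s)) (nv (x s)) x distinct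
    s′ : Fin 4
    s′ = proj₁ second
    clean₂ = proj₂ second
    s≉s′ : ¬ p∣ (x s - x s′)
    s≉s′ e = clean₂ 0F (∣-lin₁ -1ℤ e (eq (x s) (x s′)))
      where
      eq : ∀ u v → 1ℤ * v + (- u) ≡ -1ℤ * (u - v)
      eq = solve-∀
    match : ∀ s → ¬ p∣ (a * x s + b) → ¬ p∣ (c * x s + d) → p∣ (a * x s + b - (c * x s + d))
    match s u v = ≈-trans (a * x s + b) (g s) (c * x s + d) (≈-sym (g s) (a * x s + b) (ab s u)) (cd s v)

  -- Gluing four consecutive rows into one affine form.

  -- Rows carry α s * n + β s, three lines of slopes 1, 1, -1 carry a c * n + b c. The two lines of slope 1
  -- force α to be affine in the row number, with slope a 1F - a 0F, and the third line kills that slope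
  -- through a second difference.
  module Patch (4<p : 4 ℕ.< p) (t r₀ : ℤ) (a b : Fin 3 → ℤ) (α β : Fin 4 → ℤ)
    (E₀ : ∀ s → p∣ (a 0F * (t + (r₀ + ι s)) + b 0F - (α s * (t + (r₀ + ι s)) + β s)))
    (E₁ : ∀ s → p∣ (a 1F * (t + (1ℤ + (r₀ + ι s))) + b 1F - (α s * (t + (1ℤ + (r₀ + ι s))) + β s)))
    (E₂ : ∀ s → p∣ (a 2F * (t + (+ 15 - (r₀ + ι s))) + b 2F - (α s * (t + (+ 15 - (r₀ + ι s))) + β s)))
    where

    slope const A B C : ℤ
    slope = a 1F - a 0F
    const = slope * t + (a 1F + b 1F - b 0F)
    A = const
    -- `B` and `C` come from comparing coefficients of `r` in `A * (t + r) + B * r + C = a 0F * (t +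
    -- r) + b 0F`, the form along the first line.
    B = a 0F - A
    C = B * t + b 0F

    -- The first two lines meet a row in adjacent columns, so the difference of their values there
    -- is the slope of the row.
    α-affine : ∀ s → p∣ (α s - (slope * (r₀ + ι s) + const))
    α-affine s = ∣-lin₂ 1ℤ -1ℤ (E₀ s) (E₁ s) (eq t (r₀ + ι s) (a 0F) (b 0F) (a 1F) (b 1F) (α s) (β s))
      where
      eq : ∀ t r a₀ b₀ a₁ b₁ α β → α - ((a₁ - a₀) * r + ((a₁ - a₀) * t + (a₁ + b₁ - b₀))) ≡
        1ℤ * (a₀ * (t + r) + b₀ - (α * (t + r) + β)) + -1ℤ * (a₁ * (t + (1ℤ + r)) + b₁ - (α * (t + (1ℤ + r)) + β))
      eq = solve-∀

    -- On row `r` the third and first lines lie `15 - r - r` columns apart. Their values differ by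
    -- that distance times the row slope, here replaced by its affine expression.
    quadratic : ℤ → ℤ
    quadratic r = a 2F * (t + (+ 15 - r)) + b 2F - (a 0F * (t + r) + b 0F) - (slope * r + const) * (+ 15 - r - r)

    p∣quadratic : ∀ s → p∣ quadratic (r₀ + ι s)
    p∣quadratic s = ∣-lin₃ 1ℤ -1ℤ (+ 15 - r - r) (E₂ s) (E₀ s) (α-affine s)
      (eq t r (a 0F) (b 0F) (a 2F) (b 2F) (α s) (β s) slope const (+ 15))
      where
      r : ℤ
      r = r₀ + ι s
      eq : ∀ t r a₀ b₀ a₂ b₂ α β d e k →
        a₂ * (t + (k - r)) + b₂ - (a₀ * (t + r) + b₀) - (d * r + e) * (k - r - r) ≡
        1ℤ * (a₂ * (t + (k - r)) + b₂ - (α * (t + (k - r)) + β)) + -1ℤ * (a₀ * (t + r) + b₀ - (α * (t + r) + β))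
          + (k - r - r) * (α - (d * r + e))
      eq = solve-∀

    -- `quadratic` has leading coefficient `2 * slope`, hence second difference `4 * slope`.
    p∣slope : p∣ slope
    p∣slope = [ (λ p∣4 → contradiction p∣4 (∤-small 4<p)) , (λ d → d) ]′
      (euclid (+ 4) slope (∣-lin₃ 1ℤ (- (+ 2)) 1ℤ (p∣quadratic 0F) (p∣quadratic 1F) (p∣quadratic 2F)
        (eq t r₀ (a 0F) (b 0F) (a 2F) (b 2F) slope const (+ 15))))
      where
      eq : ∀ t r a₀ b₀ a₂ b₂ d e k →
        let q = λ r → a₂ * (t + (k - r)) + b₂ - (a₀ * (t + r) + b₀) - (d * r + e) * (k - r - r) in
        + 4 * d ≡ 1ℤ * q (r + + 0) + (- (+ 2)) * q (r + + 1) + 1ℤ * q (r + + 2)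
      eq = solve-∀

    α≈A : ∀ s → p∣ (α s - A)
    α≈A s = ∣-lin₂ 1ℤ (r₀ + ι s) (α-affine s) p∣slope (eq (α s) slope (r₀ + ι s) const)
      where
      eq : ∀ α d r e → α - e ≡ 1ℤ * (α - (d * r + e)) + r * d
      eq = solve-∀

    β≈ : ∀ s → p∣ (β s - (B * (r₀ + ι s) + C))
    β≈ s = ∣-lin₂ -1ℤ (- (t + (r₀ + ι s))) (E₀ s) (α≈A s) (eq t (r₀ + ι s) (a 0F) (b 0F) (α s) (β s) A)
      where
      eq : ∀ t r a₀ b₀ α β e → β - ((a₀ - e) * r + ((a₀ - e) * t + b₀)) ≡
        -1ℤ * (a₀ * (t + r) + b₀ - (α * (t + r) + β)) + (- (t + r)) * (α - e)
      eq = solve-∀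

  -- The affine functions attached to the lines of the board.

  module Board (48<p : 48 ℕ.< p) {N : ℕ} (p+p≤N : p ℕ.+ p ℕ.≤ N)
    (F : Fin N → ℤ → Fin p) (solution : IsSudokuSolution p N F) where

    below-p : ∀ {k} → k ℕ.≤ 48 → k ℕ.< p
    below-p k≤48 = ℕP.≤-<-trans k≤48 48<p

    4<p : 4 ℕ.< p
    4<p = below-p (ℕP.m≤m+n 4 44)

    val : Fin N → ℤ → ℤ
    val n m = + toℕ (F n m)

    column : ∀ k → k ℕ.< N → Fin N
    column k k<N = fromℕ< k<N

    ι-column : ∀ {k} (k<N : k ℕ.< N) → ι (column k k<N) ≡ + k
    ι-column k<N = cong +_ (FinP.toℕ-fromℕ< k<N)

    lineA lineB : ℤ → ℤ → ℤ
    lineA j i = proj₁ (proj₂ solution j i)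
    lineB j i = proj₁ (proj₂ (proj₂ solution j i))

    line-nonvanishing : ∀ j i → NonVanishing (lineA j i) (lineB j i)
    line-nonvanishing j i (d , e) =
      proj₁ (proj₂ (proj₂ (proj₂ solution j i))) (ℤS.∣⇒∣ᵤ d , ℤS.∣⇒∣ᵤ e)

    -- If `p` does not divide the value, neither does its square, so the rule applies and `f` is
    -- plain reduction.
    line-describes : ∀ j i n {m} → m ≡ j * ι n + i → ¬ p∣ (lineA j i * ι n + lineB j i) →
      p∣ (val n m - (lineA j i * ι n + lineB j i))
    line-describes j i n refl p∤z = ≡π⇒toℕ≈ z (trans
      (proj₂ (proj₂ (proj₂ (proj₂ solution j i))) n
        (λ p²∣z → p∤z (ℤS.∣ᵤ⇒∣ (ℕD.∣-trans (ℕD.m∣m*n p) p²∣z))))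
      (f≡π z p∤z))
      where
      z : ℤ
      z = lineA j i * ι n + lineB j i

    Describes : ℤ → ℤ → ℤ → Set
    Describes A B C = ∀ n m → ¬ p∣ (A * ι n + B * m + C) → p∣ (val n m - (A * ι n + B * m + C))

    -- Propagation from four rows to all rows.

    module Propagate (A B C : ℤ) where

      L : Fin N → ℤ → ℤ
      L n m = A * ι n + B * m + C

      GoodRow : ℤ → Set
      GoodRow m = ∀ n → ¬ p∣ L n m → p∣ (val n m - L n m)

      -- The line through (n , m) of slope - ε * δ meets the four rows m - ε * k, k = 1, ..., 4,
      -- in the columns n + δ * k.
      extend-along : ∀ ε δ → δ * δ ≡ 1ℤ → ∀ n m (x : Fin 4 → Fin N) →
        (∀ s → ι (x s) ≡ ι n + δ * (1ℤ + ι s)) → (∀ s → GoodRow (m - ε * (1ℤ + ι s))) →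
        ¬ p∣ L n m → p∣ (val n m - L n m)
      -- The line function is congruent to `L n m` at `n`, hence non-zero there, and so it gives the
      -- value of `F`.
      extend-along ε δ δ²≡1 n m x ιx good p∤L = ≈-trans (val n m) (a * ι n + b) (L n m)
        (line-describes j i n through-n (p∤L ∘ ∣-cong line≈L)) line≈L
        where
        j i a b c d : ℤ
        j = - (ε * δ)
        i = m + ε * δ * ι n
        a = lineA j i
        b = lineB j i
        c = A + B * j
        d = B * i + C

        through-n : m ≡ j * ι n + i
        through-n = eq ε δ m (ι n)
          where
          eq : ∀ ε δ m n → m ≡ (- (ε * δ)) * n + (m + ε * δ * n)
          eq = solve-∀

        through-x : ∀ s → m - ε * (1ℤ + ι s) ≡ j * ι (x s) + i
        -- Replacing `ε` by `ε * (δ * δ)` turns the claim into a polynomial identity.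
        through-x s = trans (cong (λ u → m - u * (1ℤ + ι s)) ε≡)
          (trans (eq ε δ m (ι n) (1ℤ + ι s)) (cong (λ u → j * u + i) (sym (ιx s))))
          where
          ε≡ : ε ≡ ε * (δ * δ)
          ε≡ = sym (trans (cong (ε *_) δ²≡1) (ℤP.*-identityʳ ε))
          eq : ∀ ε δ m n k → m - ε * (δ * δ) * k ≡ (- (ε * δ)) * (n + δ * k) + (m + ε * δ * n)
          eq = solve-∀

        L-on-line : ∀ n′ m′ → m′ ≡ j * ι n′ + i → L n′ m′ ≡ c * ι n′ + d
        L-on-line n′ _ refl = eq A B C j i (ι n′)
          where
          eq : ∀ A B C j i n → A * n + B * (j * n + i) + C ≡ (A + B * j) * n + (B * i + C)
          eq = solve-∀

        -- `c * n + d` is `L` restricted to the line; it is non-zero at the target point.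
        c-d-nonvanishing : NonVanishing c d
        c-d-nonvanishing (p∣c , p∣d) = p∤L (subst p∣_ (sym (L-on-line n m through-n))
          (∣-lin₂ (ι n) 1ℤ p∣c p∣d (eq (ι n) c d)))
          where
          eq : ∀ n c d → c * n + d ≡ n * c + 1ℤ * d
          eq = solve-∀

        x-distinct : Distinct (λ s → ι (x s))
        x-distinct {s} {s′} e = ι-distinct (ℕP.<⇒≤ 4<p) (∣-lin₁ δ e (sym (begin
          δ * (ι (x s) - ι (x s′))
            ≡⟨ cong₂ (λ u v → δ * (u - v)) (ιx s) (ιx s′) ⟩
          δ * (ι n + δ * (1ℤ + ι s) - (ι n + δ * (1ℤ + ι s′)))
            ≡⟨ eq δ (ι n) (ι s) (ι s′) ⟩
          δ * δ * (ι s - ι s′)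
            ≡⟨ cong (_* (ι s - ι s′)) δ²≡1 ⟩
          1ℤ * (ι s - ι s′)
            ≡⟨ ℤP.*-identityˡ (ι s - ι s′) ⟩
          ι s - ι s′ ∎)))
          where
          open ≡-Reasoning
          eq : ∀ δ n s s′ → δ * (n + δ * (1ℤ + s) - (n + δ * (1ℤ + s′))) ≡ δ * δ * (s - s′)
          eq = solve-∀

        coefficients : p∣ (a - c) × p∣ (b - d)
        coefficients = descriptions-agree a b c d (λ s → ι (x s)) (λ s → val (x s) (m - ε * (1ℤ + ι s)))
          (below-p (s≤s z≤n)) x-distinct (line-nonvanishing j i) c-d-nonvanishing
          (λ s → line-describes j i (x s) (through-x s))
          (λ s → subst (λ z → ¬ p∣ z → p∣ (val (x s) (m - ε * (1ℤ + ι s)) - z))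
            (L-on-line (x s) _ (through-x s)) (good s (x s)))

        line≈L : p∣ (a * ι n + b - L n m)
        line≈L = ∣-lin₂ (ι n) 1ℤ (proj₁ coefficients) (proj₂ coefficients)
          (trans (cong (λ z → a * ι n + b - z) (L-on-line n m through-n)) (eq a b c d (ι n)))
          where
          eq : ∀ a b c d n → a * n + b - (c * n + d) ≡ n * (a - c) + 1ℤ * (b - d)
          eq = solve-∀

      -- The four auxiliary columns lie to the left of `n` when there is room, and otherwise to the
      -- right, where `n < 4` keeps them on the board.
      extend : ∀ ε m → (∀ s → GoodRow (m - ε * (1ℤ + ι {4} s))) → GoodRow m
      extend ε m good n with 4 ℕ.≤? toℕ n
      ... | yes 4≤n = extend-along ε -1ℤ refl n m (λ s → column (toℕ n ℕ.∸ suc (toℕ s)) (in-range s))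
              (λ s → trans (ι-column (in-range s)) (shift s)) good
        where
        in-range : ∀ (s : Fin 4) → toℕ n ℕ.∸ suc (toℕ s) ℕ.< N
        in-range s = ℕP.≤-<-trans (ℕP.m∸n≤m (toℕ n) (suc (toℕ s))) (FinP.toℕ<n n)
        eq : ∀ u v → u - v ≡ u + -1ℤ * v
        eq = solve-∀
        shift : ∀ (s : Fin 4) → + (toℕ n ℕ.∸ suc (toℕ s)) ≡ ι n + -1ℤ * (1ℤ + ι s)
        shift s = trans (sym (ℤP.⊖-≥ (ℕP.≤-trans (FinP.toℕ<n s) 4≤n)))
          (trans (sym (ℤP.m-n≡m⊖n (toℕ n) (suc (toℕ s)))) (eq (ι n) (+ suc (toℕ s))))
      ... | no 4≰n = extend-along ε 1ℤ refl n m (λ s → column (toℕ n ℕ.+ suc (toℕ s)) (in-range s))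
              (λ s → trans (ι-column (in-range s)) (cong (λ u → ι n + u) (sym (ℤP.*-identityˡ (1ℤ + ι s))))) good
        where
        in-range : ∀ (s : Fin 4) → toℕ n ℕ.+ suc (toℕ s) ℕ.< N
        in-range s = ℕP.<-≤-trans (ℕP.+-mono-<-≤ (ℕP.<-trans (ℕP.≰⇒> 4≰n) 4<p)
          (ℕP.≤-trans (FinP.toℕ<n s) (ℕP.<⇒≤ 4<p))) p+p≤N

      GoodWindow : ℤ → Set
      GoodWindow m = ∀ (s : Fin 4) → GoodRow (m + ι s)

      window-up : ∀ m → GoodWindow m → GoodWindow (m + 1ℤ)
      window-up m good 0F = subst GoodRow (sym (ℤP.+-assoc m 1ℤ (+ 0))) (good 1F)
      window-up m good 1F = subst GoodRow (sym (ℤP.+-assoc m 1ℤ (+ 1))) (good 2F)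
      window-up m good 2F = subst GoodRow (sym (ℤP.+-assoc m 1ℤ (+ 2))) (good 3F)
      -- The only new row; the rows at distances 1 to 4 below it are the old window read downwards.
      window-up m good 3F = extend 1ℤ (m + 1ℤ + + 3) λ
        { 0F → subst GoodRow (eq₀ m) (good 3F)
        ; 1F → subst GoodRow (eq₁ m) (good 2F)
        ; 2F → subst GoodRow (eq₂ m) (good 1F)
        ; 3F → subst GoodRow (eq₃ m) (good 0F) }
        where
        eq₀ : ∀ m → m + + 3 ≡ m + 1ℤ + + 3 - 1ℤ * + 1
        eq₀ = solve-∀
        eq₁ : ∀ m → m + + 2 ≡ m + 1ℤ + + 3 - 1ℤ * + 2
        eq₁ = solve-∀
        eq₂ : ∀ m → m + + 1 ≡ m + 1ℤ + + 3 - 1ℤ * + 3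
        eq₂ = solve-∀
        eq₃ : ∀ m → m + + 0 ≡ m + 1ℤ + + 3 - 1ℤ * + 4
        eq₃ = solve-∀

      window-down : ∀ m → GoodWindow m → GoodWindow (m - 1ℤ)
      window-down m good 0F = extend -1ℤ (m - 1ℤ + + 0) (λ s → subst GoodRow (eq m (ι s)) (good s))
        where
        eq : ∀ m s → m + s ≡ m - 1ℤ + + 0 - -1ℤ * (1ℤ + s)
        eq = solve-∀
      window-down m good 1F = subst GoodRow (sym (ℤP.+-assoc m -1ℤ (+ 1))) (good 0F)
      window-down m good 2F = subst GoodRow (sym (ℤP.+-assoc m -1ℤ (+ 2))) (good 1F)
      window-down m good 3F = subst GoodRow (sym (ℤP.+-assoc m -1ℤ (+ 3))) (good 2F)

      module _ (m₀ : ℤ) (good : GoodWindow m₀) where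

        windows-above : ∀ k → GoodWindow (m₀ + + k)
        windows-above ℕ.zero = subst GoodWindow (sym (ℤP.+-identityʳ m₀)) good
        windows-above (suc k) = subst GoodWindow (eq m₀ (+ k)) (window-up (m₀ + + k) (windows-above k))
          where
          eq : ∀ m k → m + k + 1ℤ ≡ m + (1ℤ + k)
          eq = solve-∀

        windows-below : ∀ k → GoodWindow (m₀ - + k)
        windows-below ℕ.zero = subst GoodWindow (sym (ℤP.+-identityʳ m₀)) good
        windows-below (suc k) = subst GoodWindow (eq m₀ (+ k)) (window-down (m₀ - + k) (windows-below k))
          where
          eq : ∀ m k → m - k - 1ℤ ≡ m - (1ℤ + k)
          eq = solve-∀

        windows : ∀ k → GoodWindow (m₀ + k)
        windows (+ k) = windows-above k
        windows -[1+ k ] = windows-below (suc k)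

        all-rows-good : ∀ m → GoodRow m
        all-rows-good m = subst GoodRow (eq m m₀) (windows (m - m₀) 0F)
          where
          eq : ∀ m m₀ → m₀ + (m - m₀) + + 0 ≡ m
          eq = solve-∀

    -- Three lines crossing sixteen rows.

    -- Line `c` meets row `r` in column `t + offset c r`; `opposite` sends `r` to `15 - r`, so
    -- offsets are naturals.
    offset : Fin 3 → Fin 16 → ℕ
    offset 0F r = toℕ r
    offset 1F r = suc (toℕ r)
    offset 2F r = toℕ (opposite r)

    slope : Fin 3 → ℤ
    slope 0F = 1ℤ
    slope 1F = 1ℤ
    slope 2F = -1ℤ

    intercept : Fin 3 → ℤ → ℤ
    intercept 0F t = - t
    intercept 1F t = - t - 1ℤ
    intercept 2F t = t + + 15

    ι-opposite : ∀ (r : Fin 16) → + toℕ (opposite r) ≡ + 15 - ι r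
    ι-opposite r = trans (cong +_ (FinP.opposite-prop r))
      (trans (sym (ℤP.⊖-≥ (ℕ.s≤s⁻¹ (FinP.toℕ<n r)))) (sym (ℤP.m-n≡m⊖n 15 (toℕ r))))

    crossing : ∀ c t r → ι r ≡ slope c * (t + + offset c r) + intercept c t
    crossing 0F t r = eq t (ι r)
      where
      eq : ∀ t r → r ≡ 1ℤ * (t + r) + (- t)
      eq = solve-∀
    crossing 1F t r = eq t (ι r)
      where
      eq : ∀ t r → r ≡ 1ℤ * (t + (1ℤ + r)) + (- t - 1ℤ)
      eq = solve-∀
    crossing 2F t r = trans (eq t (ι r) (+ 15)) (cong (λ u → -1ℤ * (t + u) + (t + + 15)) (sym (ι-opposite r)))
      where
      eq : ∀ t r k → r ≡ -1ℤ * (t + (k - r)) + (t + k)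
      eq = solve-∀

    offset≤16 : ∀ c r → offset c r ℕ.≤ 16
    offset≤16 0F r = ℕP.<⇒≤ (FinP.toℕ<n r)
    offset≤16 1F r = FinP.toℕ<n r
    offset≤16 2F r = ℕP.<⇒≤ (FinP.toℕ<n (opposite r))

    α β : ℤ → ℤ
    α = lineA 0ℤ
    β = lineB 0ℤ

    -- 16 rows with 3 crossings each: this is where p > 48 is needed.
    clean-shift : ∃ λ (t : Fin p) → ∀ c r → ¬ p∣ (α (ι r) * (ι t + + offset c r) + β (ι r))
    clean-shift = t , clean
      where
      cell : Fin 48 → Fin 16 × Fin 3
      cell = remQuot {16} 3
      rowA rowB : Fin 16 × Fin 3 → ℤ
      rowA (r , c) = α (ι r)
      -- The row function at column `t + offset c r`, read as an affine function of the unknown `t`.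
      rowB (r , c) = α (ι r) * + offset c r + β (ι r)
      nonvanishing : ∀ rc → NonVanishing (rowA rc) (rowB rc)
      nonvanishing (r , c) (p∣α , p∣β′) = line-nonvanishing 0ℤ (ι r)
        (p∣α , ∣-lin₂ 1ℤ (- (+ offset c r)) p∣β′ p∣α (eq (α (ι r)) (β (ι r)) (+ offset c r)))
        where
        eq : ∀ α β u → β ≡ 1ℤ * (α * u + β) + (- u) * α
        eq = solve-∀
      avoided : ∃ λ (t : Fin p) → ∀ i → ¬ p∣ (rowA (cell i) * ι t + rowB (cell i))
      avoided = avoid-roots 48<p (rowA ∘ cell) (rowB ∘ cell) (λ i → nonvanishing (cell i)) ι (ι-distinct ℕP.≤-refl)
      t : Fin p
      t = proj₁ avoided
      clean : ∀ c r → ¬ p∣ (α (ι r) * (ι t + + offset c r) + β (ι r))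
      clean c r d = subst (λ rc → ¬ p∣ (rowA rc * ι t + rowB rc)) (FinP.remQuot-combine r c)
        (proj₂ avoided (combine r c)) (subst p∣_ (eq (α (ι r)) (β (ι r)) (ι t) (+ offset c r)) d)
        where
        eq : ∀ α β t u → α * (t + u) + β ≡ α * t + (α * u + β)
        eq = solve-∀

    t : ℤ
    t = ι (proj₁ clean-shift)

    -- The shift is below `p` and the offset is at most 16, so the column is below `p + p`.
    in-range : ∀ c r → toℕ (proj₁ clean-shift) ℕ.+ offset c r ℕ.< N
    in-range c r = ℕP.<-≤-trans (ℕP.+-mono-<-≤ (FinP.toℕ<n (proj₁ clean-shift))
      (ℕP.≤-trans (offset≤16 c r) (ℕP.<⇒≤ (below-p (ℕP.m≤m+n 16 32))))) p+p≤N

    cross : Fin 3 → Fin 16 → Fin N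
    cross c r = column _ (in-range c r)

    ι-cross : ∀ c r → ι (cross c r) ≡ t + + offset c r
    ι-cross c r = ι-column (in-range c r)

    a b : Fin 3 → ℤ
    a c = lineA (slope c) (intercept c t)
    b c = lineB (slope c) (intercept c t)

    on-line : ∀ c r → ι r ≡ slope c * ι (cross c r) + intercept c t
    on-line c r = trans (crossing c t r) (cong (λ u → slope c * u + intercept c t) (sym (ι-cross c r)))

    -- The column of a crossing determines its row, and the 16 row numbers are distinct modulo `p`.
    crossings-distinct : ∀ c → Distinct (λ r → ι (cross c r))
    crossings-distinct c {r} {r′} d = ι-distinct (ℕP.<⇒≤ (below-p (ℕP.m≤m+n 16 32)))
      (∣-lin₁ (slope c) d (trans (cong₂ _-_ (on-line c r) (on-line c r′))
        (eq (slope c) (intercept c t) (ι (cross c r)) (ι (cross c r′)))))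
      where
      eq : ∀ σ i u v → σ * u + i - (σ * v + i) ≡ σ * (u - v)
      eq = solve-∀

    -- Each of the three lines has a zero at one crossing at most, so it spoils at most one of the
    -- four blocks of rows `4 * k + s`.
    clean-block : ∃ λ (k : Fin 4) → ∀ c → ¬ ∃ λ (s : Fin 4) → p∣ (a c * ι (cross c (combine k s)) + b c)
    clean-block = avoid ℕP.≤-refl (λ c k → ∃ λ (s : Fin 4) → p∣ (a c * ι (cross c (combine k s)) + b c))
      (λ c k → FinP.any? (λ s → p∣? _))
      λ c {k} {k′} (s , d) (s′ , d′) → FinP.combine-injectiveˡ k s k′ s′ (crossings-distinct c
        (root-unique (a c) (b c) (ι (cross c (combine k s))) (ι (cross c (combine k′ s′)))
          (line-nonvanishing (slope c) (intercept c t)) d d′))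

    block : Fin 4
    block = proj₁ clean-block

    row : Fin 4 → Fin 16
    row s = combine block s

    r₀ : ℤ
    r₀ = + (4 ℕ.* toℕ block)

    ι-row : ∀ s → ι (row s) ≡ r₀ + ι s
    ι-row s = cong +_ (FinP.toℕ-combine block s)

    row-describes : ∀ i n → ¬ p∣ (α i * ι n + β i) → p∣ (val n i - (α i * ι n + β i))
    row-describes i n = line-describes 0ℤ i n (eq (ι n) i)
      where
      eq : ∀ n i → i ≡ 0ℤ * n + i
      eq = solve-∀

    -- At a clean crossing the row and the line both give the value of `F`. The free `x` lets the
    -- column take the shape that `Patch` expects.
    row-meets-line : ∀ c s {x} → t + + offset c (row s) ≡ x →
      p∣ (a c * x + b c - (α (ι (row s)) * x + β (ι (row s))))
    row-meets-line c s {x} eq = subst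
      (λ x → p∣ (a c * x + b c - (α (ι (row s)) * x + β (ι (row s))))) (trans (ι-cross c (row s)) eq)
      (≈-trans (a c * ι n + b c) (val n (ι (row s))) (α (ι (row s)) * ι n + β (ι (row s)))
        (≈-sym (val n (ι (row s))) (a c * ι n + b c)
          (line-describes (slope c) (intercept c t) n (on-line c (row s))
            (λ d → proj₂ clean-block c (s , d))))
        (row-describes (ι (row s)) n
          (subst (λ u → ¬ p∣ (α (ι (row s)) * u + β (ι (row s)))) (sym (ι-cross c (row s)))
            (proj₂ clean-shift c (row s)))))
      where
      n : Fin N
      n = cross c (row s)

    -- The affine form on the whole board.

    open Patch 4<p t r₀ a b (α ∘ ι ∘ row) (β ∘ ι ∘ row)
      (λ s → row-meets-line 0F s (cong (λ u → t + u) (ι-row s)))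
      (λ s → row-meets-line 1F s (cong (λ u → t + (1ℤ + u)) (ι-row s)))
      (λ s → row-meets-line 2F s (cong (λ u → t + u) (trans (ι-opposite (row s)) (cong (λ u → + 15 - u) (ι-row s)))))
      using (A; B; C; α≈A; β≈) public

    open Propagate A B C

    base-window : GoodWindow r₀
    base-window s n p∤L = subst (λ m → p∣ (val n m - L n (r₀ + ι s))) (ι-row s)
      (≈-trans (val n (ι (row s))) h (L n (r₀ + ι s)) (row-describes (ι (row s)) n (p∤L ∘ ∣-cong h≈L)) h≈L)
      where
      h : ℤ
      h = α (ι (row s)) * ι n + β (ι (row s))
      eq : ∀ α β n A B C m → α * n + β - (A * n + B * m + C) ≡ n * (α - A) + 1ℤ * (β - (B * m + C))
      eq = solve-∀
      h≈L : p∣ (h - L n (r₀ + ι s))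
      h≈L = ∣-lin₂ (ι n) 1ℤ (α≈A s) (β≈ s) (eq (α (ι (row s))) (β (ι (row s))) (ι n) A B C (r₀ + ι s))

    affine-off-zeros : Describes A B C
    affine-off-zeros n m = all-rows-good r₀ base-window m n

    -- Otherwise the function of a row in the block would vanish identically, against the rule.
    ABC-nonzero : ¬ (p∣ A × p∣ B × p∣ C)
    ABC-nonzero (p∣A , p∣B , p∣C) = line-nonvanishing 0ℤ (ι (row 0F))
      ( ∣-lin₂ 1ℤ 1ℤ (α≈A 0F) p∣A (eq₁ (α (ι (row 0F))) A)
      , ∣-lin₃ 1ℤ (r₀ + + 0) 1ℤ (β≈ 0F) p∣B p∣C (eq₂ (β (ι (row 0F))) B C (r₀ + + 0)))
      where
      eq₁ : ∀ α A → α ≡ 1ℤ * (α - A) + 1ℤ * A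
      eq₁ = solve-∀
      eq₂ : ∀ β B C r → β ≡ 1ℤ * (β - (B * r + C)) + r * B + 1ℤ * C
      eq₂ = solve-∀

    -- Uniqueness of the coefficients.

    4≤N : 4 ℕ.≤ N
    4≤N = ℕP.≤-trans (ℕP.<⇒≤ 4<p) (ℕP.≤-trans (ℕP.m≤m+n p p) p+p≤N)

    -- The two forms and their difference have a common non-zero: each vanishes on at most one column,
    -- and at most once on any other column.
    coefficients-unique : ∀ A B C A′ B′ C′ → ¬ (p∣ A × p∣ B × p∣ C) → ¬ (p∣ A′ × p∣ B′ × p∣ C′) →
      Describes A B C → Describes A′ B′ C′ → p∣ (A - A′) × p∣ (B - B′) × p∣ (C - C′)
    coefficients-unique A B C A′ B′ C′ nv nv′ desc desc′ =
      -- A non-zero difference would be a third form to avoid; yet it vanishes wherever both forms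
      -- give the value of `F`.
      decidable-stable (p∣? (A - A′) ×-dec p∣? (B - B′) ×-dec p∣? (C - C′)) absurd
      where
      As Bs Cs : Fin 3 → ℤ
      As 0F = A
      As 1F = A′
      As 2F = A - A′
      Bs 0F = B
      Bs 1F = B′
      Bs 2F = B - B′
      Cs 0F = C
      Cs 1F = C′
      Cs 2F = C - C′
      absurd : ¬ ¬ (p∣ (A - A′) × p∣ (B - B′) × p∣ (C - C′))
      absurd nv″ = nonzero 2F (subst p∣_ (eq (ι n) m A B C A′ B′ C′)
        (≈-trans (form 0F) (val n m) (form 1F)
          (≈-sym (val n m) (form 0F) (desc n m (nonzero 0F))) (desc′ n m (nonzero 1F))))
        where
        nvs : ∀ i → ¬ (p∣ As i × p∣ Bs i × p∣ Cs i)
        nvs 0F = nv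
        nvs 1F = nv′
        nvs 2F = nv″
        -- The excluded columns are those on which a form vanishes identically in `m`.
        good-column : ∃ λ (x : Fin 4) → ∀ i → ¬ (p∣ Bs i × p∣ (As i * ι x + Cs i))
        good-column = avoid ℕP.≤-refl (λ i x → p∣ Bs i × p∣ (As i * ι x + Cs i)) (λ i x → p∣? _ ×-dec p∣? _)
          λ i {x} {y} (p∣B , dx) (_ , dy) → ι-distinct (ℕP.<⇒≤ 4<p)
            (root-unique (As i) (Cs i) (ι x) (ι y) (λ (p∣A , p∣C) → nvs i (p∣A , p∣B , p∣C)) dx dy)
        n : Fin N
        n = inject≤ (proj₁ good-column) 4≤N
        ιn : ι n ≡ ι (proj₁ good-column)
        ιn = cong +_ (FinP.toℕ-inject≤ (proj₁ good-column) 4≤N)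
        good-row : ∃ λ (y : Fin 4) → ∀ i → ¬ p∣ (Bs i * ι y + (As i * ι n + Cs i))
        good-row = avoid-roots ℕP.≤-refl Bs (λ i → As i * ι n + Cs i)
          (λ i (p∣B , d) → proj₂ good-column i (p∣B , subst (λ u → p∣ (As i * u + Cs i)) ιn d))
          ι (ι-distinct (ℕP.<⇒≤ 4<p))
        m : ℤ
        m = ι (proj₁ good-row)
        form : Fin 3 → ℤ
        form i = As i * ι n + Bs i * m + Cs i
        eq′ : ∀ A B C n m → A * n + B * m + C ≡ B * m + (A * n + C)
        eq′ = solve-∀
        nonzero : ∀ i → ¬ p∣ form i
        nonzero i d = proj₂ good-row i (subst p∣_ (eq′ (As i) (Bs i) (Cs i) (ι n) m) d)
        eq : ∀ n m A B C A′ B′ C′ → A * n + B * m + C - (A′ * n + B′ * m + C′) ≡ (A - A′) * n + (B - B′) * m + (C - C′)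
        eq = solve-∀

    -- Non-constant columns.

    -- If `p` divides `B`, the form is `A * n + C` on column `n`; any column where this is non-zero
    -- is constant.
    nonconstant⇒∤ : NonConstantColumns F → ¬ p∣ B
    nonconstant⇒∤ nonconstant p∣B = nonconstant n λ m m′ →
      FinP.toℕ-injective (residue-unique (FinP.toℕ<n (F n m)) (FinP.toℕ<n (F n m′))
        (≈-trans (val n m) k (val n m′) (val≈k m) (≈-sym (val n m′) k (val≈k m′))))
      where
      good-column : ∃ λ (x : Fin 4) → ∀ (i : Fin 1) → ¬ p∣ (A * ι x + C)
      good-column = avoid-roots (s≤s (s≤s z≤n)) (λ _ → A) (λ _ → C)
        (λ _ (p∣A , p∣C) → ABC-nonzero (p∣A , p∣B , p∣C)) ι (ι-distinct (ℕP.<⇒≤ 4<p))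
      n : Fin N
      n = inject≤ (proj₁ good-column) 4≤N
      k : ℤ
      k = A * ι n + C
      p∤k : ¬ p∣ k
      p∤k d = proj₂ good-column 0F
        (subst (λ u → p∣ (A * u + C)) (cong +_ (FinP.toℕ-inject≤ (proj₁ good-column) 4≤N)) d)
      eq : ∀ A B C n m → A * n + B * m + C - (A * n + C) ≡ m * B
      eq = solve-∀
      L≈k : ∀ m → p∣ (L n m - k)
      L≈k m = ∣-lin₁ m p∣B (eq A B C (ι n) m)
      val≈k : ∀ m → p∣ (val n m - k)
      val≈k m = ≈-trans (val n m) (L n m) k (affine-off-zeros n m (p∤k ∘ ∣-cong (L≈k m))) (L≈k m)

    -- In each column some two vertically adjacent cells avoid the zeros of the form, and its values
    -- there differ by `B`.
    ∤⇒nonconstant : ¬ p∣ B → NonConstantColumns F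
    ∤⇒nonconstant p∤B n constant = p∤B (∣-lin₁ 1ℤ
      (≈-trans (L n (m + 1ℤ)) (val n m) (L n m)
        (subst (λ v → p∣ (L n (m + 1ℤ) - + toℕ v)) (constant (m + 1ℤ) m)
          (≈-sym (val n (m + 1ℤ)) (L n (m + 1ℤ)) (affine-off-zeros n (m + 1ℤ) (nonzero′ ∘ subst p∣_ (eq₁ A B C (ι n) m)))))
        (affine-off-zeros n m (nonzero ∘ subst p∣_ (eq₀ A B C (ι n) m))))
      (eq A B C (ι n) m))
      where
      consts : Fin 2 → ℤ
      consts 0F = A * ι n + C
      consts 1F = B + (A * ι n + C)
      good-row : ∃ λ (y : Fin 4) → ∀ i → ¬ p∣ (B * ι y + consts i)
      good-row = avoid-roots (s≤s (s≤s (s≤s z≤n))) (λ _ → B) consts (λ _ (p∣B , _) → p∤B p∣B)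
        ι (ι-distinct (ℕP.<⇒≤ 4<p))
      m : ℤ
      m = ι (proj₁ good-row)
      nonzero = proj₂ good-row 0F
      nonzero′ = proj₂ good-row 1F
      eq₀ : ∀ A B C n m → A * n + B * m + C ≡ B * m + (A * n + C)
      eq₀ = solve-∀
      eq₁ : ∀ A B C n m → A * n + B * (m + 1ℤ) + C ≡ B * m + (B + (A * n + C))
      eq₁ = solve-∀
      eq : ∀ A B C n m → B ≡ 1ℤ * (A * n + B * (m + 1ℤ) + C - (A * n + B * m + C))
      eq = solve-∀

-- Assembly, with translation between signed and unsigned divisibility.

open import Data.Nat using (_<_; _*_)

theorem4p7 : (p N : ℕ) .{{_ : NonZero p}} .{{_ : NonZero N}} → Prime p → 48 < p → (p * p) ∣ N →
    (F : Fin N → ℤ → Fin p) → IsSudokuSolution p N F →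
    ∃[ A ] ∃[ B ] ∃[ C ] NotAll p A B C × Represents p N F A B C ×
    ((A′ B′ C′ : ℤ) → NotAll p A′ B′ C′ → Represents p N F A′ B′ C′ →
    (π p A ≡ π p A′) × (π p B ≡ π p B′) × (π p C ≡ π p C′)) ×
    (NonConstantColumns F ⇔ ν≡0 p B)
theorem4p7 p N p-prime 48<p p²∣N F solution =
  A , B , C
  , (λ (d , e , g) → ABC-nonzero (ℤS.∣ᵤ⇒∣ d , ℤS.∣ᵤ⇒∣ e , ℤS.∣ᵤ⇒∣ g))
  , (λ n m p∤L → toℕ≈⇒≡π (A ℤ.* ι n ℤ.+ B ℤ.* m ℤ.+ C) (affine-off-zeros n m (p∤L ∘ ℤS.∣⇒∣ᵤ)))
  , (λ A′ B′ C′ not-all represents →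
      let d , e , g = coefficients-unique A B C A′ B′ C′ ABC-nonzero
            (λ (d , e , g) → not-all (ℤS.∣⇒∣ᵤ d , ℤS.∣⇒∣ᵤ e , ℤS.∣⇒∣ᵤ g)) affine-off-zeros
            (λ n m p∤L → ≡π⇒toℕ≈ (A′ ℤ.* ι n ℤ.+ B′ ℤ.* m ℤ.+ C′) (represents n m (p∤L ∘ ℤS.∣ᵤ⇒∣)))
      in ≈⇒π≡π A A′ d , ≈⇒π≡π B B′ e , ≈⇒π≡π C C′ g)
  , mk⇔ (λ nonconstant → nonconstant⇒∤ nonconstant ∘ ℤS.∣ᵤ⇒∣) (λ p∤B → ∤⇒nonconstant (p∤B ∘ ℤS.∣⇒∣ᵤ))
  where
  open ModPrime p p-prime
  p+p≤N : p ℕ.+ p ℕ.≤ N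
  -- The chain is `2 * p ≤ p * p ≤ N`, the last step by divisibility with `N` non-zero.
  p+p≤N = ℕP.≤-trans (ℕP.≤-reflexive (cong (p ℕ.+_) (sym (ℕP.+-identityʳ p))))
    (ℕP.≤-trans (ℕP.*-monoˡ-≤ p (ℕP.≤-trans (ℕP.m≤m+n 2 47) 48<p)) (ℕD.∣⇒≤ p²∣N))
  open Board 48<p p+p≤N F solution
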